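{- Let $n$ be a non-negative integer and let $a,b$ be integers with $\gcd(a,b)=1$, $b\neq 0$ and $b\neq\pm1$. Let $T_N(a,b)=\sum_{k=0}^{\lfloor N/2\rfloor}\binom{N}{k}\binom{N-k}{k}a^k b^{N-2k}$ (the generalized central trinomial coefficient, i.e. the coefficient of $x^N$ in $(x^2+bx+a)^N$). Then $$\omega_b\big(T_{2n}(a,b)\big)=\omega_b\Big(\binom{2n}{n}\Big),\qquad \omega_b\big(T_{2n+1}(a,b)\big)=1+\omega_b\Big((2n+1)\binom{2n}{n}\Big).$$
   Context: For an integer $x$ with $x\neq 0,\pm1$ and a nonzero integer $y$, $\omega_x(y)$ denotes the largest non-negative integer $e$ such that $x^e$ divides $y$. -}

module Defs where

open import Data.Empty using (⊥-elim)
open import Data.Fin.Base using (toℕ)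
open import Data.Integer.Base using (ℤ; +_; -[1+_]; 0ℤ; 1ℤ; -1ℤ; ∣_∣; _*_; _^_)
open import Data.Integer.Divisibility.Signed using (_∣_; _∣?_; ∣⇒∣ᵤ; divides)
open import Data.Integer.Properties using (+-*-semiring; abs-*; ∣i∣≡0⇒i≡0; *-identityʳ)
open import Data.Nat.Base as ℕ using (ℕ; zero; suc; _∸_; _≤_; _<_; z≤n; s≤s; ⌊_/2⌋)
open import Data.Nat.Combinatorics using (_C_)
import Data.Nat.Divisibility as ℕ
import Data.Nat.Properties as ℕ
open import Data.Product.Base using (_×_; _,_)
open import Data.Sum.Base using (inj₁; inj₂)
open import Level using (0ℓ)
open import Relation.Binary.PropositionalEquality using (_≡_; _≢_; refl; sym; trans; cong)
open import Relation.Nullary using (yes; no)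
open import Relation.Unary using (Pred; Decidable)

open import Algebra.Properties.Semiring.Sum +-*-semiring using (sum⁺-syntax)

-- The index ranges over Fin (suc ⌊ N /2⌋), so neither subtraction truncates.
T : ℕ → ℤ → ℤ → ℤ
T N a b = ∑[ k ≤ ⌊ N /2⌋ ] term (toℕ k)
  where
  term : ℕ → ℤ
  term k = + (N C k) * + ((N ∸ k) C k) * a ^ k * b ^ (N ∸ 2 ℕ.* k)

IsGreatest : Pred ℕ 0ℓ → Pred ℕ 0ℓ
IsGreatest P m = P m × (∀ k → P k → k ≤ m)

-- The value is 0 if P fails at every positive number up to the bound.
greatestUpTo : {P : Pred ℕ 0ℓ} → Decidable P → ℕ → ℕ
greatestUpTo P? zero    = zero
greatestUpTo P? (suc m) with P? (suc m)
... | yes _ = suc m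
... | no  _ = greatestUpTo P? m

greatestUpTo-isGreatest : {P : Pred ℕ 0ℓ} (P? : Decidable P) (m : ℕ) → P 0 →
                          (∀ k → P k → k ≤ m) → IsGreatest P (greatestUpTo P? m)
greatestUpTo-isGreatest P? zero    p0 bound = p0 , bound
greatestUpTo-isGreatest {P} P? (suc m) p0 bound with P? (suc m)
... | yes p = p , bound
... | no ¬p = greatestUpTo-isGreatest P? m p0 bound′
  where
  bound′ : ∀ k → P k → k ≤ m
  bound′ k pk with ℕ.m≤n⇒m<n∨m≡n (bound k pk)
  ... | inj₁ (s≤s k≤m) = k≤m
  ... | inj₂ refl      = ⊥-elim (¬p pk)

-- The bound ∣ y ∣ suffices because e < ∣ x ^ e ∣ whenever ∣ x ∣ ≥ 2; see
-- ω-isGreatest. The value is meaningful only for x ∉ {0, 1, -1} and y ≢ 0.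
ω : ℤ → ℤ → ℕ
ω x y = greatestUpTo (λ e → x ^ e ∣? y) ∣ y ∣

abs-^ : ∀ x e → ∣ x ^ e ∣ ≡ ∣ x ∣ ℕ.^ e
abs-^ x zero    = refl
abs-^ x (suc e) = trans (abs-* x (x ^ e)) (cong (∣ x ∣ ℕ.*_) (abs-^ x e))

n<m^n : ∀ {m} → 2 ≤ m → ∀ n → n < m ℕ.^ n
n<m^n         2≤m zero    = s≤s z≤n
n<m^n {m}     2≤m (suc n) = ℕ.≤-<-trans (n<m^n 2≤m n) (ℕ.^-monoʳ-< m 2≤m (ℕ.n<1+n n))

2≤∣x∣ : ∀ x → x ≢ 0ℤ → x ≢ 1ℤ → x ≢ -1ℤ → 2 ≤ ∣ x ∣
2≤∣x∣ (+ 0)           x≢0 _ _    = ⊥-elim (x≢0 refl)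
2≤∣x∣ (+ 1)           _ x≢1 _    = ⊥-elim (x≢1 refl)
2≤∣x∣ (+ suc (suc _)) _ _ _      = s≤s (s≤s z≤n)
2≤∣x∣ -[1+ 0 ]        _ _ x≢-1   = ⊥-elim (x≢-1 refl)
2≤∣x∣ -[1+ suc _ ]    _ _ _      = s≤s (s≤s z≤n)

ω-isGreatest : ∀ x y → x ≢ 0ℤ → x ≢ 1ℤ → x ≢ -1ℤ → y ≢ 0ℤ →
               IsGreatest (λ e → x ^ e ∣ y) (ω x y)
ω-isGreatest x y x≢0 x≢1 x≢-1 y≢0 =
  greatestUpTo-isGreatest (λ e → x ^ e ∣? y) ∣ y ∣ (divides y (sym (*-identityʳ y))) bound
  where
  instance
    ∣y∣≢0 : ℕ.NonZero ∣ y ∣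
    ∣y∣≢0 = ℕ.≢-nonZero (λ eq → y≢0 (∣i∣≡0⇒i≡0 eq))
  bound : ∀ e → x ^ e ∣ y → e ≤ ∣ y ∣
  bound e xᵉ∣y = begin
    e             <⟨ n<m^n (2≤∣x∣ x x≢0 x≢1 x≢-1) e ⟩
    ∣ x ∣ ℕ.^ e   ≡⟨ abs-^ x e ⟨
    ∣ x ^ e ∣     ≤⟨ ℕ.∣⇒≤ (∣⇒∣ᵤ xᵉ∣y) ⟩
    ∣ y ∣         ∎
    where open ℕ.≤-Reasoning

-- Let N = 2n + δ with δ ∈ {0, 1}, and let c(N, k) = C(N, k) C(N − k, k). For k + j = n, factorials give
-- c(N, k) c(2j + δ, j) = c(N, n) C(n, j)². Moreover c(2j + δ, j) divides the entry (2j + 1) C(2j, j) of the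
-- Leibniz harmonic triangle, so its reciprocal is an integer combination of 1, 1/2, …, 1/(2j + 1). A number
-- below 2^(2j) divides b^(2j − 1) up to a factor coprime to b, hence so does c(2j + δ, j) when j ≥ 1. Working
-- up to factors coprime to b, every term of T_N with k < n is therefore divisible by c(N, n) b^(δ + 1). The
-- remaining term is c(N, n) aⁿ b^δ with a coprime to b, so T_N agrees with c(N, n) b^δ up to such factors.

{-# OPTIONS --safe #-}
module Submission where

open import Defs
open import Data.Integer.Base using (ℤ; +_; 0ℤ; 1ℤ; -1ℤ)
open import Data.Integer.GCD using (gcd)
open import Data.Nat.Base using (ℕ; _+_; _*_)
open import Data.Nat.Combinatorics using (_C_)
open import Data.Product.Base using (_×_)
open import Relation.Binary.PropositionalEquality using (_≡_; _≢_)

open import Data.Fin.Base using (Fin; zero; suc; toℕ; fromℕ; inject₁)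
open import Data.Fin.Properties using (toℕ-fromℕ; toℕ-inject₁; toℕ<n)
open import Data.Integer.Base using (∣_∣)
import Data.Integer.Base as ℤ
import Data.Integer.Coprimality as ℤ using (Coprime)
import Data.Integer.Divisibility.Signed as ℤ
import Data.Integer.Properties as ℤ
import Data.Integer.Tactic.RingSolver as ℤ-Solver
open import Data.Nat.Base
  using (zero; suc; _∸_; _^_; _!; _≤_; _<_; z≤n; s≤s; ⌊_/2⌋; NonZero; ≢-nonZero; >-nonZero⁻¹; ≢-nonZero⁻¹)
open import Data.Nat.Combinatorics using (nCn≡1; nCk≡n!/k![n-k]!; k![n∸k]!∣n!)
open import Data.Nat.Coprimality as Coprimality using (Coprime; coprime-divisor; gcd≡1⇒coprime)
open import Data.Nat.Divisibility
open import Data.Nat.DivMod using (m/n*n≡m)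
import Data.Nat.GCD as ℕ
open import Data.Nat.Properties
open import Data.Nat.Tactic.RingSolver using (solve-∀)
open import Data.Product.Base using (_,_; proj₁; proj₂; ∃; ∃₂)
open import Data.Sum.Base using (inj₁; inj₂; [_,_]′)
open import Data.Vec.Functional using (Vector)
open import Function.Base using (_∘_)
open import Relation.Binary.PropositionalEquality
  using (refl; sym; trans; cong; cong₂; subst; subst₂; module ≡-Reasoning)
open import Relation.Nullary using (yes; no; contradiction)

open import Algebra.Properties.Semiring.Sum ℤ.+-*-semiring
  using (sum; sum-cong-≗; sum⁺-syntax; sum-init-last)

-- Divisibility up to factors coprime to `b`.

coprime-* : ∀ {b m n} → Coprime b m → Coprime b n → Coprime b (m * n)
coprime-* b⊥m b⊥n (d∣b , d∣mn) =
  b⊥n (d∣b , coprime-divisor (λ (e∣d , e∣m) → b⊥m (∣-trans e∣d d∣b , e∣m)) d∣mn)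

coprime-1 : ∀ {b} → Coprime b 1
coprime-1 = Coprimality.sym (Coprimality.1-coprimeTo _)

coprime-^ : ∀ {b m} → Coprime b m → ∀ e → Coprime b (m ^ e)
coprime-^ b⊥m zero    = coprime-1
coprime-^ b⊥m (suc e) = coprime-* b⊥m (coprime-^ b⊥m e)

-- Divisibility in the localisation of ℤ at the numbers coprime to b.
infix 4 _∣[_]_

_∣[_]_ : ℕ → ℕ → ℕ → Set
d ∣[ b ] x = ∃ λ m → Coprime b m × d ∣ m * x

∣⇒∣[] : ∀ {b d x} → d ∣ x → d ∣[ b ] x
∣⇒∣[] {x = x} d∣x = 1 , coprime-1 , ∣n⇒∣m*n 1 d∣x

∣-∣[]-trans : ∀ {b d d′ x} → d ∣ d′ → d′ ∣[ b ] x → d ∣[ b ] x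
∣-∣[]-trans d∣d′ (m , b⊥m , d′∣mx) = m , b⊥m , ∣-trans d∣d′ d′∣mx

-- The product of the two coprime multipliers serves both; with one multiplier, ordinary
-- divisibility applies to sums and differences.
∣[]-common : ∀ {b c d x y} → c ∣[ b ] x → d ∣[ b ] y →
             ∃ λ m → Coprime b m × (c ∣ m * x) × (d ∣ m * y)
∣[]-common {c = c} {d} {x} {y} (m , b⊥m , c∣mx) (n , b⊥n , d∣ny) =
  m * n , coprime-* b⊥m b⊥n ,
  subst (c ∣_) (lemma₁ m n x) (∣n⇒∣m*n n c∣mx) ,
  subst (d ∣_) (sym (*-assoc m n y)) (∣n⇒∣m*n m d∣ny)
  where
  lemma₁ : ∀ m n x → n * (m * x) ≡ m * n * x
  lemma₁ = solve-∀

∣[]-sum : ∀ {b d n} (f : Vector ℤ n) → (∀ i → d ∣[ b ] ∣ f i ∣) → d ∣[ b ] ∣ sum f ∣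
∣[]-sum {d = d} {zero}  f d∣f = ∣⇒∣[] (d ∣0)
∣[]-sum {d = d} {suc n} f d∣f
  with m , b⊥m , d∣mx , d∣my ← ∣[]-common (d∣f zero) (∣[]-sum (f ∘ suc) (d∣f ∘ suc))
  = m , b⊥m , subst (d ∣_) (abs-+m* (f zero ℤ.+ sum (f ∘ suc)))
      (ℤ.∣⇒∣ᵤ (subst (+ d ℤ.∣_) (sym (ℤ.*-distribˡ-+ (+ m) (f zero) (sum (f ∘ suc))))
        (ℤ.∣m∣n⇒∣m+n (lift (f zero) d∣mx) (lift (sum (f ∘ suc)) d∣my))))
  where
  abs-+m* : ∀ x → ∣ + m ℤ.* x ∣ ≡ m * ∣ x ∣
  abs-+m* = ℤ.abs-* (+ m)
  lift : ∀ x → d ∣ m * ∣ x ∣ → + d ℤ.∣ + m ℤ.* x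
  lift x d∣m∣x∣ = ℤ.∣ᵤ⇒∣ (subst (d ∣_) (sym (abs-+m* x)) d∣m∣x∣)

-- Splitting off gcd k b from k at least halves it.
k<2^[1+e]⇒k∣[b]b^e : ∀ b e k → .{{NonZero k}} → k < 2 ^ suc e → k ∣[ b ] b ^ e
k<2^[1+e]⇒k∣[b]b^e b zero    1 _ = ∣⇒∣[] ∣-refl
k<2^[1+e]⇒k∣[b]b^e b zero    (suc (suc _)) (s≤s (s≤s ()))
k<2^[1+e]⇒k∣[b]b^e b (suc e) k k<2^[2+e] with ℕ.gcd b k ≟ 1
-- Here `k` itself is the multiplier coprime to `b`.
... | yes g≡1 = k , gcd≡1⇒coprime g≡1 , m∣m*n _
... | no  g≢1 with divides q k≡q*g ← ℕ.gcd[m,n]∣n b k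
  = m , b⊥m , subst (_∣ m * b ^ suc e) (sym k≡q*g)
      (subst (q * g ∣_) (lemma m (b ^ e) b) (*-pres-∣ q∣mb^e (ℕ.gcd[m,n]∣m b k)))
  where
  g = ℕ.gcd b k
  instance
    qg≢0 : NonZero (q * g)
    qg≢0 = subst NonZero k≡q*g (≢-nonZero (≢-nonZero⁻¹ k))
    q≢0 : NonZero q
    q≢0 = m*n≢0⇒m≢0 q
    g≢0 : NonZero g
    g≢0 = m*n≢0⇒n≢0 q
  lemma : ∀ m x b → m * x * b ≡ m * (b * x)
  lemma = solve-∀
  q<2^[1+e] : q < 2 ^ suc e
  q<2^[1+e] = *-cancelˡ-< 2 q (2 ^ suc e) (begin-strict
    2 * q           ≤⟨ *-monoˡ-≤ q (≤∧≢⇒< (>-nonZero⁻¹ g) (g≢1 ∘ sym)) ⟩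
    g * q           ≡⟨ *-comm g q ⟩
    q * g           ≡⟨ k≡q*g ⟨
    k               <⟨ k<2^[2+e] ⟩
    2 * 2 ^ suc e   ∎)
    where open ≤-Reasoning
  IH = k<2^[1+e]⇒k∣[b]b^e b e q q<2^[1+e]
  m = proj₁ IH
  b⊥m = proj₁ (proj₂ IH)
  q∣mb^e = proj₂ (proj₂ IH)

-- The Leibniz harmonic triangle.

[i+j]Ci*i!*j!≡[i+j]! : ∀ i j → ((i + j) C i) * (i ! * j !) ≡ (i + j) !
[i+j]Ci*i!*j!≡[i+j]! i j =
  subst (λ d → ((i + j) C i) * (i ! * d !) ≡ (i + j) !) (m+n∸m≡n i j)
    (trans (cong (_* (i ! * (i + j ∸ i) !)) (nCk≡n!/k![n-k]! i≤i+j))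
           (m/n*n≡m {{i !* (i + j ∸ i) !≢0}} (k![n∸k]!∣n! i≤i+j)))
  where i≤i+j = m≤m+n i j

-- The reciprocals of these numbers form the Leibniz harmonic triangle.
leibniz : ℕ → ℕ → ℕ
leibniz i j = suc (i + j) * ((i + j) C i)

leibniz-! : ∀ i j → leibniz i j * (i ! * j !) ≡ suc (i + j) !
leibniz-! i j = trans (*-assoc (suc (i + j)) ((i + j) C i) (i ! * j !)) (cong (suc (i + j) *_) ([i+j]Ci*i!*j!≡[i+j]! i j))

leibniz-nonZero : ∀ i j → NonZero (leibniz i j)
leibniz-nonZero i j =
  m*n≢0⇒m≢0 (leibniz i j) {{subst NonZero (sym (leibniz-! i j)) (suc (i + j) !≢0)}}

-- Both sides times `i ! * j !` equal (i + j + 2)!; likewise in `leibniz-sucˡ`.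
leibniz-sucʳ : ∀ i j → leibniz i (suc j) * suc j ≡ suc (suc (i + j)) * leibniz i j
leibniz-sucʳ i j = *-cancelʳ-≡ (leibniz i (suc j) * suc j) (suc (suc (i + j)) * leibniz i j) (i ! * j !) {{i !* j !≢0}} (begin
  leibniz i (suc j) * suc j * (i ! * j !)         ≡⟨ lemma (leibniz i (suc j)) (suc j) (i !) (j !) ⟩
  leibniz i (suc j) * (i ! * (suc j) !)           ≡⟨ leibniz-! i (suc j) ⟩
  suc (i + suc j) !                               ≡⟨ cong (λ s → suc s !) (+-suc i j) ⟩
  suc (suc (i + j)) * suc (i + j) !               ≡⟨ cong (suc (suc (i + j)) *_) (leibniz-! i j) ⟨
  suc (suc (i + j)) * (leibniz i j * (i ! * j !)) ≡⟨ *-assoc (suc (suc (i + j))) (leibniz i j) (i ! * j !) ⟨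
  suc (suc (i + j)) * leibniz i j * (i ! * j !)   ∎)
  where
  open ≡-Reasoning
  lemma : ∀ x s y z → x * s * (y * z) ≡ x * (y * (s * z))
  lemma = solve-∀

leibniz-sucˡ : ∀ i j → leibniz (suc i) j * suc i ≡ suc (suc (i + j)) * leibniz i j
leibniz-sucˡ i j = *-cancelʳ-≡ (leibniz (suc i) j * suc i) (suc (suc (i + j)) * leibniz i j) (i ! * j !) {{i !* j !≢0}} (begin
  leibniz (suc i) j * suc i * (i ! * j !)         ≡⟨ lemma (leibniz (suc i) j) (suc i) (i !) (j !) ⟩
  leibniz (suc i) j * ((suc i) ! * j !)           ≡⟨ leibniz-! (suc i) j ⟩
  suc (suc (i + j)) * suc (i + j) !               ≡⟨ cong (suc (suc (i + j)) *_) (leibniz-! i j) ⟨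
  suc (suc (i + j)) * (leibniz i j * (i ! * j !)) ≡⟨ *-assoc (suc (suc (i + j))) (leibniz i j) (i ! * j !) ⟨
  suc (suc (i + j)) * leibniz i j * (i ! * j !)   ∎)
  where
  open ≡-Reasoning
  lemma : ∀ x s y z → x * s * (y * z) ≡ x * (s * y * z)
  lemma = solve-∀

-- The harmonic recursion 1/L(i,j) = 1/L(i,j+1) + 1/L(i+1,j) with denominators cleared.
leibniz-rule : ∀ i j → leibniz (suc i) j * leibniz i (suc j) ≡
               leibniz i j * (leibniz i (suc j) + leibniz (suc i) j)
leibniz-rule i j = *-cancelʳ-≡ (E * A) (B * (A + E)) (suc (suc (i + j))) (begin
  -- i + j + 2 = (i + 1) + (j + 1), one summand for each neighbour relation.
  E * A * suc (suc (i + j))               ≡⟨ lemma₁ A E i j ⟩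
  A * (E * suc i) + E * (A * suc j)       ≡⟨ cong₂ (λ x y → A * x + E * y) (leibniz-sucˡ i j) (leibniz-sucʳ i j) ⟩
  A * (s * B) + E * (s * B)               ≡⟨ lemma₂ A B E s ⟩
  B * (A + E) * s                         ∎)
  where
  open ≡-Reasoning
  s = suc (suc (i + j))
  A = leibniz i (suc j)
  B = leibniz i j
  E = leibniz (suc i) j
  lemma₁ : ∀ A E i j → E * A * (1 + (1 + (i + j))) ≡ A * (E * (1 + i)) + E * (A * (1 + j))
  lemma₁ = solve-∀
  lemma₂ : ∀ A B E s → A * (s * B) + E * (s * B) ≡ B * (A + E) * s
  lemma₂ = solve-∀

-- For nonzero numbers the equation says 1/E = 1/B - 1/A, so M/E is the difference of the integers
-- M/B = x and M/A = y; `Ex≡Ey+M` states this without subtraction.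
reciprocal-difference-∣ : ∀ {A B E M} → .{{NonZero A}} → E * A ≡ B * (A + E) → A ∣ M → B ∣ M → E ∣ M
reciprocal-difference-∣ {A} {B} {E} {M} EA≡B[A+E] (divides y M≡yA) (divides x M≡xB) =
  ∣m+n∣m⇒∣n {m = E * y} (subst (E ∣_) Ex≡Ey+M (m∣m*n x)) (m∣m*n y)
  where
  open ≡-Reasoning
  lemma₁ : ∀ A E x → E * x * A ≡ x * (E * A)
  lemma₁ = solve-∀
  lemma₂ : ∀ A B E x → x * (B * (A + E)) ≡ E * (x * B) + x * B * A
  lemma₂ = solve-∀
  lemma₃ : ∀ A E M y → E * (y * A) + M * A ≡ (E * y + M) * A
  lemma₃ = solve-∀
  Ex≡Ey+M : E * x ≡ E * y + M
  Ex≡Ey+M = *-cancelʳ-≡ (E * x) (E * y + M) A (begin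
    E * x * A                 ≡⟨ lemma₁ A E x ⟩
    x * (E * A)               ≡⟨ cong (x *_) EA≡B[A+E] ⟩
    x * (B * (A + E))         ≡⟨ lemma₂ A B E x ⟩
    E * (x * B) + x * B * A   ≡⟨ cong (λ z → E * z + z * A) M≡xB ⟨
    E * M + M * A             ≡⟨ cong (λ z → E * z + M * A) M≡yA ⟩
    E * (y * A) + M * A       ≡⟨ lemma₃ A E M y ⟩
    (E * y + M) * A           ∎)

-- Induction on `i`: by the harmonic recursion the reciprocal of an entry is the difference of two
-- reciprocals with smaller `i`, down to the border entries j + 1. Neither of the two raises the row
-- i + j, so every border entry met is at most `R`.
leibniz-∣[] : ∀ {b M R} → (∀ q → q < R → suc q ∣[ b ] M) →
              ∀ i j → i + j < R → leibniz i j ∣[ b ] M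
leibniz-∣[] {b} {M} q∣M zero    j j<R =
  subst (_∣[ b ] M) (sym (*-identityʳ (suc j))) (q∣M j j<R)
leibniz-∣[] {R = R} q∣M (suc i) j i+j<R
  with m , b⊥m , A∣mM , B∣mM ← ∣[]-common
         (leibniz-∣[] q∣M i (suc j) (subst (_< R) (sym (+-suc i j)) i+j<R))
         (leibniz-∣[] q∣M i j (<⇒≤ i+j<R))
  = m , b⊥m , reciprocal-difference-∣ {{leibniz-nonZero i (suc j)}} (leibniz-rule i j) A∣mM B∣mM

-- Trinomial coefficients.

trinomial : ℕ → ℕ → ℕ
trinomial N k = (N C k) * ((N ∸ k) C k)

-- So c(N, k) is the multinomial coefficient N!/(k! k! l!): choose k of N, then k of the remaining k
-- + l. Writing N as a sum avoids truncated subtraction.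
trinomial-! : ∀ {N} k l → N ≡ k + (k + l) → trinomial N k * (k ! * (k ! * l !)) ≡ N !
trinomial-! k l refl = begin
  (N C k) * ((N ∸ k) C k) * (k ! * (k ! * l !))         ≡⟨ cong (λ r → (N C k) * (r C k) * (k ! * (k ! * l !))) (m+n∸m≡n k (k + l)) ⟩
  (N C k) * ((k + l) C k) * (k ! * (k ! * l !))         ≡⟨ lemma (N C k) ((k + l) C k) (k !) (k ! * l !) ⟩
  (N C k) * (k ! * (((k + l) C k) * (k ! * l !)))       ≡⟨ cong (λ x → (N C k) * (k ! * x)) ([i+j]Ci*i!*j!≡[i+j]! k l) ⟩
  (N C k) * (k ! * (k + l) !)                           ≡⟨ [i+j]Ci*i!*j!≡[i+j]! k (k + l) ⟩
  N !                                                   ∎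
  where
  open ≡-Reasoning
  N = k + (k + l)
  lemma : ∀ x y z w → x * y * (z * w) ≡ x * (z * (y * w))
  lemma = solve-∀

trinomial-nonZero : ∀ k l → NonZero (trinomial (k + (k + l)) k)
trinomial-nonZero k l =
  m*n≢0⇒m≢0 (trinomial (k + (k + l)) k)
    {{subst NonZero (sym (trinomial-! k l refl)) ((k + (k + l)) !≢0)}}

trinomial≡leibniz : ∀ n → trinomial (n + (n + 1)) n ≡ leibniz n n
trinomial≡leibniz n = *-cancelʳ-≡ (trinomial N n) (leibniz n n) (n ! * n !) {{n !* n !≢0}} (begin
  trinomial N n * (n ! * n !)           ≡⟨ cong (λ x → trinomial N n * (n ! * x)) (*-identityʳ (n !)) ⟨
  trinomial N n * (n ! * (n ! * 1 !))   ≡⟨ trinomial-! n 1 refl ⟩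
  N !                                   ≡⟨ cong _! (lemma n) ⟩
  suc (n + n) !                         ≡⟨ leibniz-! n n ⟨
  leibniz n n * (n ! * n !)             ∎)
  where
  open ≡-Reasoning
  N = n + (n + 1)
  lemma : ∀ n → n + (n + 1) ≡ 1 + (n + n)
  lemma = solve-∀

-- The second factor is `n C n`. The `+ 0` is kept so that both parities share the shape
-- `n + (n + δ)`.
trinomial≡binomial : ∀ n → trinomial (n + (n + 0)) n ≡ ((n + (n + 0)) C n)
trinomial≡binomial n = begin
  (N C n) * ((N ∸ n) C n) ≡⟨ cong (λ r → (N C n) * (r C n)) (trans (m+n∸m≡n n (n + 0)) (+-identityʳ n)) ⟩
  (N C n) * (n C n)       ≡⟨ cong ((N C n) *_) (nCn≡1 n) ⟩
  (N C n) * 1             ≡⟨ *-identityʳ _ ⟩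
  N C n                   ∎
  where
  open ≡-Reasoning
  N = n + (n + 0)

-- The quotient is 2j + 1 for δ = 0 and 1 for δ = 1.
trinomial-∣-leibniz : ∀ {δ} → δ ≤ 1 → ∀ j → trinomial (j + (j + δ)) j ∣ leibniz j j
trinomial-∣-leibniz z≤n j =
  divides (suc (j + j)) (cong (suc (j + j) *_)
    (trans (cong (λ r → (j + r) C j) (sym (+-identityʳ j))) (sym (trinomial≡binomial j))))
trinomial-∣-leibniz (s≤s z≤n) j = ∣-reflexive (trinomial≡leibniz j)

-- Both sides times (k! j!)² δ! equal N!. Hence c(N, k) becomes a multiple of the central c(N, n)
-- once the second factor has been paid for with powers of b.
trinomial-* : ∀ k j δ {N} → N ≡ k + j + (k + j + δ) →
              trinomial N k * trinomial (j + (j + δ)) j ≡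
              trinomial N (k + j) * (((k + j) C k) * ((k + j) C k))
trinomial-* k j δ {N} eq =
  *-cancelʳ-≡ (t * Q) (D * (E * E)) (k ! * j ! * (k ! * j !) * δ !)
    {{m*n≢0 (K * J * (K * J)) d {{m*n≢0 (K * J) (K * J) {{k !* j !≢0}} {{k !* j !≢0}}}} {{δ !≢0}}}} (begin
  t * Q * (K * J * (K * J) * d)     ≡⟨ lemma₁ t Q K J d ⟩
  t * (K * (K * (Q * (J * (J * d))))) ≡⟨ cong (λ x → t * (K * (K * x))) (trinomial-! j δ refl) ⟩
  t * (K * (K * (l !)))             ≡⟨ trinomial-! k l (trans eq (lemma₂ k j δ)) ⟩
  N !                               ≡⟨ trinomial-! (k + j) δ eq ⟨
  D * ((k + j) ! * ((k + j) ! * d)) ≡⟨ cong (λ x → D * (x * (x * d))) ([i+j]Ci*i!*j!≡[i+j]! k j) ⟨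
  D * (E * (K * J) * (E * (K * J) * d)) ≡⟨ lemma₃ D E (K * J) d ⟩
  D * (E * E) * (K * J * (K * J) * d)   ∎)
  where
  open ≡-Reasoning
  l = j + (j + δ)
  t = trinomial N k
  Q = trinomial l j
  D = trinomial N (k + j)
  E = (k + j) C k
  K = k !
  J = j !
  d = δ !
  lemma₁ : ∀ t Q K J d → t * Q * (K * J * (K * J) * d) ≡ t * (K * (K * (Q * (J * (J * d)))))
  lemma₁ = solve-∀
  lemma₂ : ∀ k j δ → k + j + (k + j + δ) ≡ k + (k + (j + (j + δ)))
  lemma₂ = solve-∀
  lemma₃ : ∀ D E x d → D * (E * x * (E * x * d)) ≡ D * (E * E) * (x * x * d)
  lemma₃ = solve-∀

-- Divisibility of the terms with k < n.

3+e<2^[2+e] : ∀ e → 3 + e < 2 ^ (2 + e)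
3+e<2^[2+e] zero    = ≤-refl
3+e<2^[2+e] (suc e) = begin-strict
  1 + (3 + e)                         <⟨ +-mono-≤-< (m^n>0 2 (2 + e)) (3+e<2^[2+e] e) ⟩
  2 ^ (2 + e) + 2 ^ (2 + e)           ≡⟨ cong (λ x → 2 ^ (2 + e) + x) (+-identityʳ _) ⟨
  2 ^ (3 + e)                         ∎
  where open ≤-Reasoning

-- With j = `suc i`, row 2j of the triangle involves denominators up to 2j + 1 = `3 + (i + i)`, all
-- below 2^(2j), so each divides b^(2j - 1) up to coprime factors.
trinomial-∣[b]b^ : ∀ b {δ} → δ ≤ 1 → ∀ i →
                   trinomial (suc i + (suc i + δ)) (suc i) ∣[ b ] b ^ suc (i + i)
trinomial-∣[b]b^ b δ≤1 i = ∣-∣[]-trans (trinomial-∣-leibniz δ≤1 (suc i))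
  (leibniz-∣[] {R = 3 + (i + i)}
    (λ q q<R → k<2^[1+e]⇒k∣[b]b^e b (suc (i + i)) (suc q) (≤-<-trans q<R (3+e<2^[2+e] (i + i))))
    (suc i) (suc i) (s≤s (s≤s (≤-reflexive (+-suc i i)))))

-- The exponent N - 2k = 2j + δ splits as e + (δ + 1): b^e supplies the factor
-- `trinomial (j + (j + δ)) j`, which completes the coefficient to a multiple of c(N, n), and b^(δ +
-- 1) is left over.
term-∣[] : ∀ a b {δ} k j {N e} → let n = k + j in
           N ≡ n + (n + δ) → j + j ≡ suc e → trinomial (j + (j + δ)) j ∣[ b ] b ^ e →
           trinomial N n * b ^ suc δ ∣[ b ] trinomial N k * a ^ k * b ^ (N ∸ 2 * k)
term-∣[] a b {δ} k j {N} {e} eq 2j≡1+e (m , b⊥m , divides q mb^e≡qQ) =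
  m , b⊥m , divides (q * E * E * a ^ k) (begin
  m * (t * a ^ k * b ^ (N ∸ 2 * k))        ≡⟨ cong (λ r → m * (t * a ^ k * b ^ r)) exponent ⟩
  m * (t * a ^ k * b ^ (e + suc δ))        ≡⟨ cong (λ x → m * (t * a ^ k * x)) (^-distribˡ-+-* b e (suc δ)) ⟩
  m * (t * a ^ k * (b ^ e * b ^ suc δ))    ≡⟨ lemma₁ m t (a ^ k) (b ^ e) (b ^ suc δ) ⟩
  m * b ^ e * (t * a ^ k * b ^ suc δ)      ≡⟨ cong (_* (t * a ^ k * b ^ suc δ)) mb^e≡qQ ⟩
  q * Q * (t * a ^ k * b ^ suc δ)          ≡⟨ lemma₂ q Q t (a ^ k) (b ^ suc δ) ⟩
  t * Q * (q * a ^ k * b ^ suc δ)          ≡⟨ cong (_* (q * a ^ k * b ^ suc δ)) (trinomial-* k j δ eq) ⟩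
  D * (E * E) * (q * a ^ k * b ^ suc δ)    ≡⟨ lemma₃ D E q (a ^ k) (b ^ suc δ) ⟩
  q * E * E * a ^ k * (D * b ^ suc δ)      ∎)
  where
  open ≡-Reasoning
  t = trinomial N k
  Q = trinomial (j + (j + δ)) j
  D = trinomial N (k + j)
  E = (k + j) C k
  lemma₀ : ∀ k j δ → k + j + (k + j + δ) ≡ 2 * k + (j + j + δ)
  lemma₀ = solve-∀
  exponent : N ∸ 2 * k ≡ e + suc δ
  exponent = begin
    N ∸ 2 * k                       ≡⟨ cong (_∸ 2 * k) (trans eq (lemma₀ k j δ)) ⟩
    2 * k + (j + j + δ) ∸ 2 * k     ≡⟨ m+n∸m≡n (2 * k) (j + j + δ) ⟩
    j + j + δ                       ≡⟨ cong (λ r → r + δ) 2j≡1+e ⟩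
    suc e + δ                       ≡⟨ +-suc e δ ⟨
    e + suc δ                       ∎
  lemma₁ : ∀ m t x y z → m * (t * x * (y * z)) ≡ m * y * (t * x * z)
  lemma₁ = solve-∀
  lemma₂ : ∀ q Q t x z → q * Q * (t * x * z) ≡ t * Q * (q * x * z)
  lemma₂ = solve-∀
  lemma₃ : ∀ D E q x z → D * (E * E) * (q * x * z) ≡ q * E * E * x * (D * z)
  lemma₃ = solve-∀

-- Splitting the sum `T`.

term : ℕ → ℤ → ℤ → ℕ → ℤ
term N a b k = + (N C k) ℤ.* + ((N ∸ k) C k) ℤ.* a ℤ.^ k ℤ.* b ℤ.^ (N ∸ 2 * k)

abs-term : ∀ N a b k → ∣ term N a b k ∣ ≡ trinomial N k * ∣ a ∣ ^ k * ∣ b ∣ ^ (N ∸ 2 * k)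
abs-term N a b k = begin
  ∣ term N a b k ∣
    ≡⟨ ℤ.abs-* (+ (N C k) ℤ.* + ((N ∸ k) C k) ℤ.* a ℤ.^ k) (b ℤ.^ (N ∸ 2 * k)) ⟩
  ∣ + (N C k) ℤ.* + ((N ∸ k) C k) ℤ.* a ℤ.^ k ∣ * ∣ b ℤ.^ (N ∸ 2 * k) ∣
    ≡⟨ cong₂ _*_ (ℤ.abs-* (+ (N C k) ℤ.* + ((N ∸ k) C k)) (a ℤ.^ k)) (abs-^ b (N ∸ 2 * k)) ⟩
  ∣ + (N C k) ℤ.* + ((N ∸ k) C k) ∣ * ∣ a ℤ.^ k ∣ * ∣ b ∣ ^ (N ∸ 2 * k)
    ≡⟨ cong₂ (λ x y → x * y * ∣ b ∣ ^ (N ∸ 2 * k)) (ℤ.abs-* (+ (N C k)) (+ ((N ∸ k) C k))) (abs-^ a k) ⟩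
  trinomial N k * ∣ a ∣ ^ k * ∣ b ∣ ^ (N ∸ 2 * k) ∎
  where open ≡-Reasoning

⌊n+[n+δ]/2⌋≡n : ∀ {δ} → δ ≤ 1 → ∀ n → ⌊ n + (n + δ) /2⌋ ≡ n
⌊n+[n+δ]/2⌋≡n z≤n       n = trans (cong (λ r → ⌊ n + r /2⌋) (+-identityʳ n)) (sym (n≡⌊n+n/2⌋ n))
-- The floor of half of `suc (n + n)` is by definition the ceiling of half of `n + n`.
⌊n+[n+δ]/2⌋≡n (s≤s z≤n) n =
  trans (cong ⌊_/2⌋ (trans (cong (λ r → n + r) (+-comm n 1)) (+-suc n n))) (sym (n≡⌈n+n/2⌉ n))

-- The term k = n is set apart because b occurs in it with exponent N - 2n = δ only, one less than
-- what is shown for the other terms.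
T-split : ∀ {δ} → δ ≤ 1 → ∀ n a b → let N = n + (n + δ) in
  T N a b ≡ sum (λ (i : Fin n) → term N a b (toℕ i)) ℤ.+ + trinomial N n ℤ.* a ℤ.^ n ℤ.* b ℤ.^ δ
T-split {δ} δ≤1 n a b = begin
  T N a b
    -- `term` copies the summand local to `T`, so unfolding suffices.
    ≡⟨⟩
  ∑[ k ≤ ⌊ N /2⌋ ] term N a b (toℕ k)
    ≡⟨ cong (λ h → ∑[ k ≤ h ] term N a b (toℕ k)) (⌊n+[n+δ]/2⌋≡n δ≤1 n) ⟩
  ∑[ k ≤ n ] term N a b (toℕ k)
    ≡⟨ sum-init-last (λ (k : Fin (suc n)) → term N a b (toℕ k)) ⟩
  sum (λ (i : Fin n) → term N a b (toℕ (inject₁ i))) ℤ.+ term N a b (toℕ (fromℕ n))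
    ≡⟨ cong₂ ℤ._+_ (sum-cong-≗ {n} (λ i → cong (term N a b) (toℕ-inject₁ i))) (cong (term N a b) (toℕ-fromℕ n)) ⟩
  sum (λ (i : Fin n) → term N a b (toℕ i)) ℤ.+ term N a b n
    ≡⟨ cong (λ x → sum (λ (i : Fin n) → term N a b (toℕ i)) ℤ.+ x) last-term ⟩
  sum (λ (i : Fin n) → term N a b (toℕ i)) ℤ.+ + trinomial N n ℤ.* a ℤ.^ n ℤ.* b ℤ.^ δ ∎
  where
  open ≡-Reasoning
  N = n + (n + δ)
  lemma : ∀ n δ → n + (n + δ) ≡ 2 * n + δ
  lemma = solve-∀
  last-term : term N a b n ≡ + trinomial N n ℤ.* a ℤ.^ n ℤ.* b ℤ.^ δ
  last-term = cong₂ (λ x e → x ℤ.* a ℤ.^ n ℤ.* b ℤ.^ e) (sym (ℤ.pos-* (N C n) ((N ∸ n) C n)))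
    (trans (cong (_∸ 2 * n) (lemma n δ)) (m+n∸m≡n (2 * n) δ))

init-∣[] : ∀ {δ} → δ ≤ 1 → ∀ n a b → let N = n + (n + δ) in
  trinomial N n * ∣ b ∣ ^ suc δ ∣[ ∣ b ∣ ] ∣ sum (λ (i : Fin n) → term N a b (toℕ i)) ∣
init-∣[] {δ} δ≤1 n a b = ∣[]-sum (λ (i : Fin n) → term N a b (toℕ i)) (λ i → term-∣ (toℕ i) (toℕ<n i))
  where
  N = n + (n + δ)
  term-∣ : ∀ k → k < n → trinomial N n * ∣ b ∣ ^ suc δ ∣[ ∣ b ∣ ] ∣ term N a b k ∣
  -- k < n makes j = n - k positive; it is written `suc i`, so that 2j - 1 is `suc (i + i)`.
  term-∣ k k<n with i , 1+k+i≡n ← m≤n⇒∃[o]m+o≡n k<n =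
    subst₂ (λ r x → trinomial N r * ∣ b ∣ ^ suc δ ∣[ ∣ b ∣ ] x) k+j≡n (sym (abs-term N a b k))
      (term-∣[] (∣ a ∣) (∣ b ∣) k (suc i) (cong (λ r → r + (r + δ)) (sym k+j≡n))
        (cong suc (+-suc i i)) (trinomial-∣[b]b^ (∣ b ∣) δ≤1 i))
    where
    k+j≡n : k + suc i ≡ n
    k+j≡n = trans (+-suc k i) 1+k+i≡n

-- Associates in the localisation.

-- x and y differ by a unit of the localisation of ℤ at the numbers coprime to b.
AssociateAt : ℤ → ℤ → ℤ → Set
AssociateAt b x y = ∃₂ λ u v → ℤ.Coprime b u × ℤ.Coprime b v × u ℤ.* x ≡ v ℤ.* y

AssociateAt-sym : ∀ {b x y} → AssociateAt b x y → AssociateAt b y x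
AssociateAt-sym (u , v , b⊥u , b⊥v , eq) = v , u , b⊥v , b⊥u , sym eq

-- If m S = w D b^(δ + 1), then m (S + D x b^δ) = (w b + m x) b^δ D, and w b + m x is coprime to b
-- because m x is.
+-associate : ∀ {b x} S D δ → ℤ.Coprime b x → D * ∣ b ∣ ^ suc δ ∣[ ∣ b ∣ ] ∣ S ∣ →
              AssociateAt b (S ℤ.+ + D ℤ.* x ℤ.* b ℤ.^ δ) (b ℤ.^ δ ℤ.* + D)
+-associate {b} {x} S D δ b⊥x (m , b⊥m , Db^∣mS) = + m , w ℤ.* b ℤ.+ + m ℤ.* x , b⊥m , b⊥u , (begin
  + m ℤ.* (S ℤ.+ + D ℤ.* x ℤ.* b ℤ.^ δ)
    ≡⟨ lemma₁ (+ m) S (+ D) x (b ℤ.^ δ) ⟩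
  + m ℤ.* S ℤ.+ + m ℤ.* x ℤ.* (b ℤ.^ δ ℤ.* + D)
    ≡⟨ cong (ℤ._+ + m ℤ.* x ℤ.* (b ℤ.^ δ ℤ.* + D)) mS≡wDbb^ ⟩
  w ℤ.* (+ D ℤ.* (b ℤ.* b ℤ.^ δ)) ℤ.+ + m ℤ.* x ℤ.* (b ℤ.^ δ ℤ.* + D)
    ≡⟨ lemma₂ w (+ m) (+ D) b x (b ℤ.^ δ) ⟩
  (w ℤ.* b ℤ.+ + m ℤ.* x) ℤ.* (b ℤ.^ δ ℤ.* + D) ∎)
  where
  open ≡-Reasoning
  abs-Db^ : ∣ + D ℤ.* b ℤ.^ suc δ ∣ ≡ D * ∣ b ∣ ^ suc δ
  abs-Db^ = trans (ℤ.abs-* (+ D) (b ℤ.^ suc δ)) (cong (D *_) (abs-^ b (suc δ)))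
  Db^∣mS′ : + D ℤ.* b ℤ.^ suc δ ℤ.∣ + m ℤ.* S
  Db^∣mS′ = ℤ.∣ᵤ⇒∣ (subst₂ _∣_ (sym abs-Db^) (sym (ℤ.abs-* (+ m) S)) Db^∣mS)
  w = ℤ._∣_.quotient Db^∣mS′
  mS≡wDbb^ = ℤ._∣_.equality Db^∣mS′
  b⊥mx : ℤ.Coprime b (+ m ℤ.* x)
  b⊥mx = subst (Coprime (∣ b ∣)) (sym (ℤ.abs-* (+ m) x)) (coprime-* b⊥m b⊥x)
  b⊥u : ℤ.Coprime b (w ℤ.* b ℤ.+ + m ℤ.* x)
  b⊥u {d} (d∣b , d∣u) = b⊥mx (d∣b , ℤ.∣⇒∣ᵤ {+ d}
    (ℤ.∣m+n∣m⇒∣n {m = w ℤ.* b} (ℤ.∣ᵤ⇒∣ d∣u) (ℤ.∣n⇒∣m*n w (ℤ.∣ᵤ⇒∣ d∣b))))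
  lemma₁ : ∀ m S D x y → m ℤ.* (S ℤ.+ D ℤ.* x ℤ.* y) ≡ m ℤ.* S ℤ.+ m ℤ.* x ℤ.* (y ℤ.* D)
  lemma₁ = ℤ-Solver.solve-∀
  lemma₂ : ∀ w m D b x y → w ℤ.* (D ℤ.* (b ℤ.* y)) ℤ.+ m ℤ.* x ℤ.* (y ℤ.* D) ≡
                           (w ℤ.* b ℤ.+ m ℤ.* x) ℤ.* (y ℤ.* D)
  lemma₂ = ℤ-Solver.solve-∀

T-associate : ∀ {δ} → δ ≤ 1 → ∀ n a b → ℤ.Coprime b a →
  AssociateAt b (T (n + (n + δ)) a b) (b ℤ.^ δ ℤ.* + trinomial (n + (n + δ)) n)
T-associate {δ} δ≤1 n a b b⊥a =
  subst (λ t → AssociateAt b t (b ℤ.^ δ ℤ.* + trinomial (n + (n + δ)) n)) (sym (T-split δ≤1 n a b))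
    (+-associate (sum (λ (i : Fin n) → term (n + (n + δ)) a b (toℕ i))) (trinomial (n + (n + δ)) n) δ
      (subst (Coprime (∣ b ∣)) (sym (abs-^ a n)) (coprime-^ b⊥a n)) (init-∣[] δ≤1 n a b))

-- b^e divides u x = v y, and v is coprime to b^e, so it cancels.
AssociateAt-∣ : ∀ b {x y} → AssociateAt b x y → ∀ e → b ℤ.^ e ℤ.∣ x → b ℤ.^ e ℤ.∣ y
AssociateAt-∣ b {x} {y} (u , v , _ , b⊥v , ux≡vy) e b^e∣x = ℤ.∣ᵤ⇒∣
  (coprime-divisor
    (subst (λ c → Coprime c ∣ v ∣) (sym (abs-^ b e))
      (Coprimality.sym (coprime-^ (Coprimality.sym b⊥v) e)))
    (subst (∣ b ℤ.^ e ∣ ∣_) (ℤ.abs-* v y)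
      (ℤ.∣⇒∣ᵤ (subst (b ℤ.^ e ℤ.∣_) ux≡vy (ℤ.∣n⇒∣m*n u b^e∣x)))))

-- Valuations of associates and of `T`.

*-≢0 : ∀ {x y} → x ≢ 0ℤ → y ≢ 0ℤ → x ℤ.* y ≢ 0ℤ
*-≢0 {x} x≢0 y≢0 = [ x≢0 , y≢0 ]′ ∘ ℤ.i*j≡0⇒i≡0∨j≡0 x

^-≢0 : ∀ {x} → x ≢ 0ℤ → ∀ e → x ℤ.^ e ≢ 0ℤ
^-≢0 {x} x≢0 e = x≢0 ∘ ℤ.i^n≡0⇒i≡0 x e

module _ {b : ℤ} (b≢0 : b ≢ 0ℤ) (b≢1 : b ≢ 1ℤ) (b≢-1 : b ≢ -1ℤ) where

  private instance
    b-nonZero : ℤ.NonZero b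
    b-nonZero = ℤ.≢-nonZero b≢0

  -- x = 0 forces v y = 0, hence v = 0, but 0 is coprime to b only if |b| = 1. This yields the
  -- nonvanishing of `T`.
  AssociateAt-≢0 : ∀ {x y} → AssociateAt b x y → y ≢ 0ℤ → x ≢ 0ℤ
  AssociateAt-≢0 (u , v , _ , b⊥v , ux≡vy) y≢0 refl
    with ℤ.i*j≡0⇒i≡0∨j≡0 v (trans (sym ux≡vy) (ℤ.*-zeroʳ u))
  ... | inj₁ refl = contradiction (2≤∣x∣ b b≢0 b≢1 b≢-1)
                      (<-irrefl (sym (Coprimality.0-coprimeTo-m⇒m≡1 (Coprimality.sym b⊥v))))
  ... | inj₂ y≡0  = y≢0 y≡0

  ω-isGreatestAt : ∀ y → y ≢ 0ℤ → IsGreatest (λ e → b ℤ.^ e ℤ.∣ y) (ω b y)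
  ω-isGreatestAt y = ω-isGreatest b y b≢0 b≢1 b≢-1

  -- Associates are divisible by the same powers of b, so each maximum bounds the other.
  ω-associate : ∀ {x y} → AssociateAt b x y → x ≢ 0ℤ → y ≢ 0ℤ → ω b x ≡ ω b y
  ω-associate {x} {y} x~y x≢0 y≢0
    with b^∣x , x-max ← ω-isGreatestAt x x≢0 | b^∣y , y-max ← ω-isGreatestAt y y≢0
    = ≤-antisym (y-max (ω b x) (AssociateAt-∣ b x~y (ω b x) b^∣x))
                (x-max (ω b y) (AssociateAt-∣ b (AssociateAt-sym {b} {x} {y} x~y) (ω b y) b^∣y))

  ω-b* : ∀ {y} → y ≢ 0ℤ → ω b (b ℤ.* y) ≡ 1 + ω b y
  ω-b* {y} y≢0 = ≤-antisym
    (bound _ (proj₁ (ω-isGreatestAt (b ℤ.* y) by≢0)))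
    (proj₂ (ω-isGreatestAt (b ℤ.* y) by≢0) _ (ℤ.*-monoʳ-∣ b (proj₁ (ω-isGreatestAt y y≢0))))
    where
    by≢0 = *-≢0 b≢0 y≢0
    bound : ∀ k → b ℤ.^ k ℤ.∣ b ℤ.* y → k ≤ suc (ω b y)
    bound zero    _      = z≤n
    bound (suc k) b^∣by = s≤s (proj₂ (ω-isGreatestAt y y≢0) k (ℤ.*-cancelˡ-∣ b b^∣by))

  ω-b^* : ∀ δ {y} → y ≢ 0ℤ → ω b (b ℤ.^ δ ℤ.* y) ≡ δ + ω b y
  ω-b^* zero    {y} y≢0 = cong (ω b) (ℤ.*-identityˡ y)
  ω-b^* (suc δ) {y} y≢0 = trans (cong (ω b) (ℤ.*-assoc b (b ℤ.^ δ) y))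
    (trans (ω-b* (*-≢0 (^-≢0 b≢0 δ) y≢0)) (cong suc (ω-b^* δ y≢0)))

  -- Nonvanishing is carried along since `ω b 0ℤ` is 0 although every power of b divides 0.
  ω-T : ∀ {δ} → δ ≤ 1 → ∀ n a → ℤ.Coprime b a → let N = n + (n + δ) in
        T N a b ≢ 0ℤ × ω b (T N a b) ≡ δ + ω b (+ trinomial N n)
  ω-T {δ} δ≤1 n a b⊥a = T≢0 , trans (ω-associate T~ T≢0 b^D≢0) (ω-b^* δ D≢0)
    where
    N = n + (n + δ)
    T~ = T-associate δ≤1 n a b b⊥a
    D≢0 : + trinomial N n ≢ 0ℤ
    D≢0 eq = ≢-nonZero⁻¹ (trinomial N n) {{trinomial-nonZero n δ}} (ℤ.+-injective eq)
    b^D≢0 = *-≢0 (^-≢0 b≢0 δ) D≢0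
    T≢0 = AssociateAt-≢0 T~ b^D≢0

-- The two parities.

theorem8 : ∀ (n : ℕ) (a b : ℤ) → gcd a b ≡ 1ℤ → b ≢ 0ℤ → b ≢ 1ℤ → b ≢ -1ℤ →
    (T (2 * n) a b ≢ 0ℤ ×
    ω b (T (2 * n) a b) ≡ ω b (+ ((2 * n) C n))) ×
    (T (2 * n + 1) a b ≢ 0ℤ ×
    ω b (T (2 * n + 1) a b) ≡ 1 + ω b (+ ((2 * n + 1) * ((2 * n) C n))))
theorem8 n a b gcd≡1 b≢0 b≢1 b≢-1 = even , odd
  where
  b⊥a : ℤ.Coprime b a
  b⊥a = Coprimality.sym (gcd≡1⇒coprime (ℤ.+-injective gcd≡1))
  -- `2 * n` reduces to `n + (n + 0)`, so the case δ = 0 applies with no rewriting of the index.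
  even = subst (λ D → T (2 * n) a b ≢ 0ℤ × ω b (T (2 * n) a b) ≡ ω b (+ D))
    (trinomial≡binomial n) (ω-T b≢0 b≢1 b≢-1 z≤n n a b⊥a)
  -- For δ = 1 the index is rearranged, and the central coefficient is `leibniz n n`, that is (2n +
  -- 1) C(2n, n).
  odd = subst₂ (λ N D → T N a b ≢ 0ℤ × ω b (T N a b) ≡ 1 + ω b (+ D)) (lemma₁ n)
    (trans (trinomial≡leibniz n)
      (cong₂ (λ x y → x * (y C n)) (lemma₂ n) (lemma₃ n)))
    (ω-T b≢0 b≢1 b≢-1 ≤-refl n a b⊥a)
    where
    lemma₁ : ∀ n → n + (n + 1) ≡ 2 * n + 1
    lemma₁ = solve-∀
    lemma₂ : ∀ n → 1 + (n + n) ≡ 2 * n + 1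
    lemma₂ = solve-∀
    lemma₃ : ∀ n → n + n ≡ 2 * n
    lemma₃ = solve-∀
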